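{- Let $(I,\preccurlyeq)$ be a directed set, let $S(\Lambda^{\succcurlyeq})$ be a contravariant direct spectrum over $(I,\preccurlyeq)$ with sets $\lambda_0(i)$, transports $\lambda^{\succcurlyeq}_{ji}$ and Bishop spaces $\mathcal F_i=(\lambda_0(i),F_i)$, let $(J,e,\mathrm{cof}_J)$ be a cofinal subset of $I$, and let $S(\Lambda^{\succcurlyeq})\circ e$ be the relative spectrum of $S(\Lambda^{\succcurlyeq})$ to $J$, with Bishop spaces $\mathcal F_j:=\mathcal F_{e(j)}$. Then $\underset{\leftarrow}{\mathrm{Lim}}\,\mathcal F_j\simeq\underset{\leftarrow}{\mathrm{Lim}}\,\mathcal F_i$, where the left side is the inverse limit of $S(\Lambda^{\succcurlyeq})\circ e$ over $J$.
   Context: Work in Bishop-style constructive mathematics (no choice principles). Each set has its own equality; functions respect it; $e$ is an embedding if $e(j)=e(j')\Rightarrow j=j'$. A directed set: a set with a reflexive transitive relation respecting equality, any two elements having a common upper bound. A contravariant direct family over $(I,\preccurlyeq)$: sets $\lambda_0(i)$ and, for $i\preccurlyeq j$, functions $\lambda^{\succcurlyeq}_{ji}:\lambda_0(j)\to\lambda_0(i)$ with $\lambda^{\succcurlyeq}_{ii}=\mathrm{id}$ and $\lambda^{\succcurlyeq}_{ki}=\lambda^{\succcurlyeq}_{ji}\circ\lambda^{\succcurlyeq}_{kj}$ for $i\preccurlyeq j\preccurlyeq k$. Bishop spaces: a Bishop topology on $X$ is a set $F$ of functions $X\to\mathbb R$ containing constants, closed under addition, composition with functions $\mathbb R\to\mathbb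 R$ uniformly continuous on every $[-n,n]$, and uniform limits; $\bigvee F_0$ = least Bishop topology containing $F_0$; Bishop morphism $(X,F)\to(Y,G)$: a function $h$ with $g\circ h\in F$ for all $g\in G$; Bishop isomorphism: bijective Bishop morphism with Bishop-morphism inverse; $\simeq$: Bishop isomorphic. A contravariant direct spectrum: a contravariant direct family with Bishop topologies $F_i$ such that all $\lambda^{\succcurlyeq}_{ji}$ are Bishop morphisms. Cofinal subset $(J,e,\mathrm{cof}_J)$: a set $J$, an embedding $e:J\to I$ (with $j\preccurlyeq j'$ iff $e(j)\preccurlyeq e(j')$), a function $\mathrm{cof}_J:I\to J$ with $\mathrm{cof}_J(e(j))=j$, $i\preccurlyeq i'\Rightarrow\mathrm{cof}_J(i)\preccurlyeq\mathrm{cof}_J(i')$, and $i\preccurlyeq e(\mathrm{cof}_J(i))$. The relative spectrum over $(J,\preccurlyeq)$ has sets $\lambda_0(e(j))$, transports $\lambda^{\succcurlyeq}_{e(j')e(j)}$ for $j\preccurlyeq j'$, topologies $F_{e(j)}$. Inverse limit: $\prod^{\succcurlyeq}\lambda_0(i)$ = dependent assignments $\Phi$ with $\Phi_i\in\lambda_0(i)$ and $\Phi_i=\lambda^{\succcurlyeq}_{ji}(\Phi_j)$ for $i\preccurlyeq j$ (pointwise equality); $\pi_i(\Phi)=\Phi_i$; $\underset{\leftarrow}{\mathrm{Lim}}\,\mathcal F_i=(\prod^{\succcurlyeq}\lambda_0(i),\bigvee\{f\circ\pi_i:i\in I,f\in F_i\})$. -}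

module Defs where

open import Level using (Level; _⊔_; 0ℓ) renaming (suc to lsuc)
open import Data.Integer as ℤ using (+_; +[1+_]; -[1+_])
import Data.Integer.Properties as ℤ
import Data.Integer.Tactic.RingSolver as ℤSolver
open import Data.Nat as ℕ using (ℕ; suc)
open import Data.Nat.Coprimality using (1-coprimeTo)
import Data.Nat.Properties as ℕ
open import Data.Product using (_×_; _,_; ∃-syntax)
open import Data.Rational as ℚ using (ℚ; mkℚ; 0ℚ)
import Data.Rational.Properties as ℚ
open import Data.Rational.Solver using (module +-*-Solver)
open import Data.Rational.Unnormalised using (*≡*)
import Data.Rational.Unnormalised.Properties as ℚᵘ
open import Data.Sum using (inj₁; inj₂)
open import Function.Bundles using (Func; Injection; Inverse; _⟨$⟩_)
import Function.Construct.Composition as Compose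
open import Function.Properties.Inverse using (toFunction; fromFunction)
import Function.Relation.Binary.Setoid.Equality as Pointwise
open import Relation.Binary.Bundles using (Setoid; Preorder)
open import Relation.Binary.PropositionalEquality
  using (_≡_; refl; sym; trans; cong; cong₂; subst)
open import Relation.Unary using (Pred; _∈_; _⊆_)

private
  variable
    a ℓ₁ b ℓ₂ c ℓ r t t′ : Level

------------------------------------------------------------------------
-- Bishop's real numbers

-- Sequences are indexed from 0, so the index n stands for Bishop's n + 1.

1/1+_ : ℕ → ℚ
1/1+ n = mkℚ (+ 1) n (1-coprimeTo (suc n))

record ℝ : Set where
  constructor mkℝ
  field
    seq     : ℕ → ℚ
    regular : ∀ m n → ℚ.∣ seq m ℚ.- seq n ∣ ℚ.≤ 1/1+ m ℚ.+ 1/1+ n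

open ℝ

infix 4 _≃_ _≤_ _<_

_≃_ : ℝ → ℝ → Set
x ≃ y = ∀ n → ℚ.∣ seq x n ℚ.- seq y n ∣ ℚ.≤ 1/1+ n ℚ.+ 1/1+ n

private

  -- With the shift of indices, n ↦ twice n is Bishop's n ↦ 2n.
  twice : ℕ → ℕ
  twice n = suc (n ℕ.+ n)

  abstract

    halve : ∀ n → 1/1+ (twice n) ℚ.+ 1/1+ (twice n) ≡ 1/1+ n
    halve n = ℚ.toℚᵘ-injective
      (ℚᵘ.≃-trans (ℚ.toℚᵘ-homo-+ (1/1+ (twice n)) (1/1+ (twice n))) (*≡* (lemma (+ n))))
      where
      lemma : ∀ m →
        (+ 1 ℤ.* (+ 1 ℤ.+ (+ 1 ℤ.+ (m ℤ.+ m))) ℤ.+ + 1 ℤ.* (+ 1 ℤ.+ (+ 1 ℤ.+ (m ℤ.+ m))))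
          ℤ.* (+ 1 ℤ.+ m)
        ≡ + 1 ℤ.* ((+ 1 ℤ.+ (+ 1 ℤ.+ (m ℤ.+ m))) ℤ.* (+ 1 ℤ.+ (+ 1 ℤ.+ (m ℤ.+ m))))
      lemma = ℤSolver.solve-∀

    0≤1/1+ : ∀ n → 0ℚ ℚ.≤ 1/1+ n
    0≤1/1+ n = ℚ.nonNegative⁻¹ (1/1+ n)

    archimedean₀ : ∀ p → (∀ k → p ℚ.≤ 1/1+ k) → p ℚ.≤ 0ℚ
    archimedean₀ (mkℚ -[1+ _ ] _ _) _ = ℚ.*≤* ℤ.-≤+
    archimedean₀ (mkℚ (+ 0) _ _) _ = ℚ.*≤* (ℤ.+≤+ ℕ.z≤n)
    archimedean₀ (mkℚ +[1+ m ] d _) p≤ with p≤ (suc d)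
    ... | ℚ.*≤* le with () ← ℕ.<⇒≱ (ℕ.n<1+n (suc d))
      (ℕ.≤-trans (ℕ.m≤m+n (suc (suc d)) (m ℕ.* suc (suc d)))
        (ℕ.≤-trans (ℤ.drop‿+≤+ le) (ℕ.≤-reflexive (ℕ.*-identityˡ (suc d)))))

    archimedean : ∀ {p q} → (∀ k → p ℚ.≤ q ℚ.+ 1/1+ k) → p ℚ.≤ q
    archimedean {p} {q} p≤ = begin
      p                    ≡⟨ lemma₁ p q ⟩
      (p ℚ.- q) ℚ.+ q      ≤⟨ ℚ.+-monoˡ-≤ q (archimedean₀ (p ℚ.- q) λ k →
                                subst (p ℚ.- q ℚ.≤_) (lemma₂ q (1/1+ k))
                                  (ℚ.+-monoˡ-≤ (ℚ.- q) (p≤ k))) ⟩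
      0ℚ ℚ.+ q             ≡⟨ ℚ.+-identityˡ q ⟩
      q                    ∎
      where
      open ℚ.≤-Reasoning
      open +-*-Solver
      lemma₁ : ∀ p q → p ≡ (p ℚ.- q) ℚ.+ q
      lemma₁ = solve 2 (λ p q → p := (p :- q) :+ q) refl
      lemma₂ : ∀ q r → (q ℚ.+ r) ℚ.- q ≡ r
      lemma₂ = solve 2 (λ q r → (q :+ r) :- q := r) refl

    dist-sym : ∀ p q → ℚ.∣ p ℚ.- q ∣ ≡ ℚ.∣ q ℚ.- p ∣
    dist-sym p q = trans (cong ℚ.∣_∣ (lemma p q)) (ℚ.∣-p∣≡∣p∣ (q ℚ.- p))
      where
      open +-*-Solver
      lemma : ∀ p q → p ℚ.- q ≡ ℚ.- (q ℚ.- p)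
      lemma = solve 2 (λ p q → p :- q := :- (q :- p)) refl

    dist-tri : ∀ p q r → ℚ.∣ p ℚ.- r ∣ ℚ.≤ ℚ.∣ p ℚ.- q ∣ ℚ.+ ℚ.∣ q ℚ.- r ∣
    dist-tri p q r = subst (λ x → ℚ.∣ x ∣ ℚ.≤ ℚ.∣ p ℚ.- q ∣ ℚ.+ ℚ.∣ q ℚ.- r ∣)
      (lemma p q r) (ℚ.∣p+q∣≤∣p∣+∣q∣ (p ℚ.- q) (q ℚ.- r))
      where
      open +-*-Solver
      lemma : ∀ p q r → (p ℚ.- q) ℚ.+ (q ℚ.- r) ≡ p ℚ.- r
      lemma = solve 3 (λ p q r → (p :- q) :+ (q :- r) := p :- r) refl

    dist-+ : ∀ p p′ q q′ →
             ℚ.∣ (p ℚ.+ p′) ℚ.- (q ℚ.+ q′) ∣ ℚ.≤ ℚ.∣ p ℚ.- q ∣ ℚ.+ ℚ.∣ p′ ℚ.- q′ ∣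
    dist-+ p p′ q q′ = subst (λ x → ℚ.∣ x ∣ ℚ.≤ ℚ.∣ p ℚ.- q ∣ ℚ.+ ℚ.∣ p′ ℚ.- q′ ∣)
      (lemma p p′ q q′) (ℚ.∣p+q∣≤∣p∣+∣q∣ (p ℚ.- q) (p′ ℚ.- q′))
      where
      open +-*-Solver
      lemma : ∀ p p′ q q′ → (p ℚ.- q) ℚ.+ (p′ ℚ.- q′) ≡ (p ℚ.+ p′) ℚ.- (q ℚ.+ q′)
      lemma = solve 4 (λ p p′ q q′ →
        (p :- q) :+ (p′ :- q′) := (p :+ p′) :- (q :+ q′)) refl

    dist-neg : ∀ p q → ℚ.∣ (ℚ.- p) ℚ.- (ℚ.- q) ∣ ≡ ℚ.∣ p ℚ.- q ∣
    dist-neg p q = trans (cong ℚ.∣_∣ (lemma p q)) (ℚ.∣-p∣≡∣p∣ (p ℚ.- q))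
      where
      open +-*-Solver
      lemma : ∀ p q → (ℚ.- p) ℚ.- (ℚ.- q) ≡ ℚ.- (p ℚ.- q)
      lemma = solve 2 (λ p q → (:- p) :- (:- q) := :- (p :- q)) refl

    ∣p∣-∣q∣≤ : ∀ p q → ℚ.∣ p ∣ ℚ.- ℚ.∣ q ∣ ℚ.≤ ℚ.∣ p ℚ.- q ∣
    ∣p∣-∣q∣≤ p q = begin
      ℚ.∣ p ∣ ℚ.- ℚ.∣ q ∣
        ≡⟨ cong (λ x → ℚ.∣ x ∣ ℚ.- ℚ.∣ q ∣) (lemma₁ p q) ⟩
      ℚ.∣ (p ℚ.- q) ℚ.+ q ∣ ℚ.- ℚ.∣ q ∣
        ≤⟨ ℚ.+-monoˡ-≤ (ℚ.- ℚ.∣ q ∣) (ℚ.∣p+q∣≤∣p∣+∣q∣ (p ℚ.- q) q) ⟩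
      (ℚ.∣ p ℚ.- q ∣ ℚ.+ ℚ.∣ q ∣) ℚ.- ℚ.∣ q ∣
        ≡⟨ lemma₂ ℚ.∣ p ℚ.- q ∣ ℚ.∣ q ∣ ⟩
      ℚ.∣ p ℚ.- q ∣ ∎
      where
      open ℚ.≤-Reasoning
      open +-*-Solver
      lemma₁ : ∀ p q → p ≡ (p ℚ.- q) ℚ.+ q
      lemma₁ = solve 2 (λ p q → p := (p :- q) :+ q) refl
      lemma₂ : ∀ p q → (p ℚ.+ q) ℚ.- q ≡ p
      lemma₂ = solve 2 (λ p q → (p :+ q) :- q := p) refl

    dist-abs : ∀ p q → ℚ.∣ ℚ.∣ p ∣ ℚ.- ℚ.∣ q ∣ ∣ ℚ.≤ ℚ.∣ p ℚ.- q ∣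
    dist-abs p q with ℚ.∣p∣≡p∨∣p∣≡-p (ℚ.∣ p ∣ ℚ.- ℚ.∣ q ∣)
    ... | inj₁ eq = subst (ℚ._≤ ℚ.∣ p ℚ.- q ∣) (sym eq) (∣p∣-∣q∣≤ p q)
    ... | inj₂ eq = begin
      ℚ.∣ ℚ.∣ p ∣ ℚ.- ℚ.∣ q ∣ ∣    ≡⟨ eq ⟩
      ℚ.- (ℚ.∣ p ∣ ℚ.- ℚ.∣ q ∣)    ≡⟨ lemma ℚ.∣ p ∣ ℚ.∣ q ∣ ⟩
      ℚ.∣ q ∣ ℚ.- ℚ.∣ p ∣          ≤⟨ ∣p∣-∣q∣≤ q p ⟩
      ℚ.∣ q ℚ.- p ∣                ≡⟨ dist-sym q p ⟩
      ℚ.∣ p ℚ.- q ∣                ∎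
      where
      open ℚ.≤-Reasoning
      open +-*-Solver
      lemma : ∀ p q → ℚ.- (p ℚ.- q) ≡ q ℚ.- p
      lemma = solve 2 (λ p q → :- (p :- q) := q :- p) refl

    dist-refl : ∀ p m n → ℚ.∣ p ℚ.- p ∣ ℚ.≤ 1/1+ m ℚ.+ 1/1+ n
    dist-refl p m n = subst (λ x → ℚ.∣ x ∣ ℚ.≤ 1/1+ m ℚ.+ 1/1+ n) (sym (ℚ.+-inverseʳ p))
      (ℚ.+-mono-≤ (0≤1/1+ m) (0≤1/1+ n))

    ≃-trans : ∀ {x y z} → x ≃ y → y ≃ z → x ≃ z
    ≃-trans {x} {y} {z} x≃y y≃z n = archimedean λ k →
      let m = twice (twice (twice k))
          d = 1/1+ n
          e = 1/1+ m
      in begin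
        ℚ.∣ seq x n ℚ.- seq z n ∣
          ≤⟨ dist-tri (seq x n) (seq x m) (seq z n) ⟩
        ℚ.∣ seq x n ℚ.- seq x m ∣ ℚ.+ ℚ.∣ seq x m ℚ.- seq z n ∣
          ≤⟨ ℚ.+-mono-≤ (regular x n m) (ℚ.≤-trans (dist-tri (seq x m) (seq y m) (seq z n))
               (ℚ.+-mono-≤ (x≃y m) (ℚ.≤-trans (dist-tri (seq y m) (seq z m) (seq z n))
                 (ℚ.+-mono-≤ (y≃z m) (regular z m n))))) ⟩
        (d ℚ.+ e) ℚ.+ ((e ℚ.+ e) ℚ.+ ((e ℚ.+ e) ℚ.+ (e ℚ.+ d)))
          ≡⟨ ℚ.+-identityʳ _ ⟨
        ((d ℚ.+ e) ℚ.+ ((e ℚ.+ e) ℚ.+ ((e ℚ.+ e) ℚ.+ (e ℚ.+ d)))) ℚ.+ 0ℚ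
          ≤⟨ ℚ.+-monoʳ-≤ ((d ℚ.+ e) ℚ.+ ((e ℚ.+ e) ℚ.+ ((e ℚ.+ e) ℚ.+ (e ℚ.+ d))))
               (ℚ.+-mono-≤ (0≤1/1+ m) (0≤1/1+ m)) ⟩
        ((d ℚ.+ e) ℚ.+ ((e ℚ.+ e) ℚ.+ ((e ℚ.+ e) ℚ.+ (e ℚ.+ d)))) ℚ.+ (e ℚ.+ e)
          ≡⟨ lemma d e ⟩
        (d ℚ.+ d) ℚ.+ (((e ℚ.+ e) ℚ.+ (e ℚ.+ e)) ℚ.+ ((e ℚ.+ e) ℚ.+ (e ℚ.+ e)))
          ≡⟨ cong ((d ℚ.+ d) ℚ.+_) (eighth k) ⟩
        (d ℚ.+ d) ℚ.+ 1/1+ k ∎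
      where
      open ℚ.≤-Reasoning
      open +-*-Solver
      lemma : ∀ d e →
        ((d ℚ.+ e) ℚ.+ ((e ℚ.+ e) ℚ.+ ((e ℚ.+ e) ℚ.+ (e ℚ.+ d)))) ℚ.+ (e ℚ.+ e)
        ≡ (d ℚ.+ d) ℚ.+ (((e ℚ.+ e) ℚ.+ (e ℚ.+ e)) ℚ.+ ((e ℚ.+ e) ℚ.+ (e ℚ.+ e)))
      lemma = solve 2 (λ d e →
        ((d :+ e) :+ ((e :+ e) :+ ((e :+ e) :+ (e :+ d)))) :+ (e :+ e)
        := (d :+ d) :+ (((e :+ e) :+ (e :+ e)) :+ ((e :+ e) :+ (e :+ e)))) refl
      quarter : ∀ k → let e = 1/1+ (twice (twice k)) in (e ℚ.+ e) ℚ.+ (e ℚ.+ e) ≡ 1/1+ k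
      quarter k = trans (cong₂ ℚ._+_ (halve (twice k)) (halve (twice k))) (halve k)
      eighth : ∀ k → let e = 1/1+ (twice (twice (twice k))) in
               ((e ℚ.+ e) ℚ.+ (e ℚ.+ e)) ℚ.+ ((e ℚ.+ e) ℚ.+ (e ℚ.+ e)) ≡ 1/1+ k
      eighth k = trans (cong₂ ℚ._+_ (quarter (twice k)) (quarter (twice k))) (halve k)

    ≃-sym : ∀ {x y} → x ≃ y → y ≃ x
    ≃-sym {x} {y} x≃y n =
      subst (ℚ._≤ 1/1+ n ℚ.+ 1/1+ n) (dist-sym (seq x n) (seq y n)) (x≃y n)

    sum-close : ∀ p p′ q q′ {d e} → ℚ.∣ p ℚ.- q ∣ ℚ.≤ d → ℚ.∣ p′ ℚ.- q′ ∣ ℚ.≤ e →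
                ℚ.∣ (p ℚ.+ p′) ℚ.- (q ℚ.+ q′) ∣ ℚ.≤ d ℚ.+ e
    sum-close p p′ q q′ p≈q p′≈q′ = ℚ.≤-trans (dist-+ p p′ q q′) (ℚ.+-mono-≤ p≈q p′≈q′)

    halve₂ : ∀ m n → (1/1+ (twice m) ℚ.+ 1/1+ (twice n)) ℚ.+ (1/1+ (twice m) ℚ.+ 1/1+ (twice n))
                     ≡ 1/1+ m ℚ.+ 1/1+ n
    halve₂ m n = trans (lemma (1/1+ (twice m)) (1/1+ (twice n))) (cong₂ ℚ._+_ (halve m) (halve n))
      where
      open +-*-Solver
      lemma : ∀ p q → (p ℚ.+ q) ℚ.+ (p ℚ.+ q) ≡ (p ℚ.+ p) ℚ.+ (q ℚ.+ q)
      lemma = solve 2 (λ p q → (p :+ q) :+ (p :+ q) := (p :+ p) :+ (q :+ q)) refl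

    +-regular : ∀ x y m n →
      ℚ.∣ (seq x (twice m) ℚ.+ seq y (twice m)) ℚ.- (seq x (twice n) ℚ.+ seq y (twice n)) ∣
        ℚ.≤ 1/1+ m ℚ.+ 1/1+ n
    +-regular x y m n = ℚ.≤-trans
      (sum-close (seq x (twice m)) (seq y (twice m)) (seq x (twice n)) (seq y (twice n))
        (regular x (twice m) (twice n)) (regular y (twice m) (twice n)))
      (ℚ.≤-reflexive (halve₂ m n))

    neg-regular : ∀ x m n →
      ℚ.∣ (ℚ.- seq x m) ℚ.- (ℚ.- seq x n) ∣ ℚ.≤ 1/1+ m ℚ.+ 1/1+ n
    neg-regular x m n =
      subst (ℚ._≤ 1/1+ m ℚ.+ 1/1+ n) (sym (dist-neg (seq x m) (seq x n))) (regular x m n)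

    abs-regular : ∀ x m n →
      ℚ.∣ ℚ.∣ seq x m ∣ ℚ.- ℚ.∣ seq x n ∣ ∣ ℚ.≤ 1/1+ m ℚ.+ 1/1+ n
    abs-regular x m n = ℚ.≤-trans (dist-abs (seq x m) (seq x n)) (regular x m n)

ℝ-setoid : Setoid 0ℓ 0ℓ
ℝ-setoid = record
  { Carrier       = ℝ
  ; _≈_           = _≃_
  ; isEquivalence = record
    { refl  = λ {x} n → dist-refl (seq x n) n n
    ; sym   = λ {x} {y} → ≃-sym {x} {y}
    ; trans = λ {x} {y} {z} → ≃-trans {x} {y} {z}
    }
  }

fromℚ : ℚ → ℝ
fromℚ q = mkℝ (λ _ → q) (dist-refl q)

fromℕ : ℕ → ℝ
fromℕ n = fromℚ (+ n ℚ./ 1)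

0ℝ : ℝ
0ℝ = fromℚ 0ℚ

infixl 6 _+_ _-_
infix  8 -_

_+_ : ℝ → ℝ → ℝ
x + y = mkℝ (λ n → seq x (twice n) ℚ.+ seq y (twice n)) (+-regular x y)

-_ : ℝ → ℝ
- x = mkℝ (λ n → ℚ.- seq x n) (neg-regular x)

_-_ : ℝ → ℝ → ℝ
x - y = x + (- y)

∣_∣ : ℝ → ℝ
∣ x ∣ = mkℝ (λ n → ℚ.∣ seq x n ∣) (abs-regular x)

abstract

  +-cong : ∀ {x x′ y y′} → x ≃ x′ → y ≃ y′ → x + y ≃ x′ + y′
  +-cong {x} {x′} {y} {y′} x≃x′ y≃y′ n = ℚ.≤-trans
    (sum-close (seq x (twice n)) (seq y (twice n)) (seq x′ (twice n)) (seq y′ (twice n))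
      (x≃x′ (twice n)) (y≃y′ (twice n)))
    (ℚ.≤-reflexive (halve₂ n n))

Positive : Pred ℝ 0ℓ
Positive x = ∃[ n ] 1/1+ n ℚ.< seq x n

NonNegative : Pred ℝ 0ℓ
NonNegative x = ∀ n → ℚ.- (1/1+ n) ℚ.≤ seq x n

_<_ : ℝ → ℝ → Set
x < y = Positive (y - x)

_≤_ : ℝ → ℝ → Set
x ≤ y = NonNegative (y - x)

------------------------------------------------------------------------
-- Real-valued functions

infixr 9 _∘ₛ_

_∘ₛ_ : {X : Setoid a ℓ₁} {Y : Setoid b ℓ₂} {Z : Setoid c ℓ} →
       Func Y Z → Func X Y → Func X Z
g ∘ₛ f = Compose.function f g

module _ (X : Setoid a ℓ₁) where

  RealFunc : Set (a ⊔ ℓ₁)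
  RealFunc = Func X ℝ-setoid

  constᶠ : ℝ → RealFunc
  constᶠ r = record { to = λ _ → r ; cong = λ _ → Setoid.refl ℝ-setoid {r} }

module _ {X : Setoid a ℓ₁} where

  infix 4 _≈ᶠ_

  _≈ᶠ_ : RealFunc X → RealFunc X → Set a
  _≈ᶠ_ = Pointwise._≈_ X ℝ-setoid

  _+ᶠ_ : RealFunc X → RealFunc X → RealFunc X
  f +ᶠ g = record
    { to   = λ x → (f ⟨$⟩ x) + (g ⟨$⟩ x)
    ; cong = λ {x} {y} x≈y →
        +-cong {f ⟨$⟩ x} {f ⟨$⟩ y} {g ⟨$⟩ x} {g ⟨$⟩ y} (Func.cong f x≈y) (Func.cong g x≈y)
    }

  IsUniformLimit : Pred (RealFunc X) t → Pred (RealFunc X) (a ⊔ ℓ₁ ⊔ t)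
  IsUniformLimit F f =
    ∀ ε → 0ℝ < ε → ∃[ g ] g ∈ F × (∀ x → ∣ (g ⟨$⟩ x) - (f ⟨$⟩ x) ∣ ≤ ε)

_∈[-_,_] : ℝ → ℕ → ℕ → Set
x ∈[- m , n ] = - fromℕ m ≤ x × x ≤ fromℕ n

UniformlyContinuousOnBounded : Pred (RealFunc ℝ-setoid) 0ℓ
UniformlyContinuousOnBounded φ =
  ∀ n ε → 0ℝ < ε → ∃[ δ ] 0ℝ < δ ×
    (∀ x y → x ∈[- n , n ] → y ∈[- n , n ] →
     ∣ x - y ∣ < δ → ∣ (φ ⟨$⟩ x) - (φ ⟨$⟩ y) ∣ ≤ ε)

------------------------------------------------------------------------
-- Bishop spaces

module _ {X : Setoid a ℓ₁} where

  -- The field resp says that F is a subset of the set of real-valued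
  -- functions on X, whose equality is pointwise.
  record IsBishopTopology (F : Pred (RealFunc X) t) : Set (a ⊔ ℓ₁ ⊔ t) where
    field
      resp  : ∀ {f g} → f ≈ᶠ g → f ∈ F → g ∈ F
      const : ∀ r → constᶠ X r ∈ F
      add   : ∀ {f g} → f ∈ F → g ∈ F → f +ᶠ g ∈ F
      comp  : ∀ {f} φ → UniformlyContinuousOnBounded φ → f ∈ F → φ ∘ₛ f ∈ F
      limit : ∀ {f} → IsUniformLimit F f → f ∈ F

  data ⋁ (F₀ : Pred (RealFunc X) t) : Pred (RealFunc X) (a ⊔ ℓ₁ ⊔ t) where
    incl  : ∀ {f} → f ∈ F₀ → f ∈ ⋁ F₀
    resp  : ∀ {f g} → f ≈ᶠ g → f ∈ ⋁ F₀ → g ∈ ⋁ F₀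
    const : ∀ r → constᶠ X r ∈ ⋁ F₀
    add   : ∀ {f g} → f ∈ ⋁ F₀ → g ∈ ⋁ F₀ → f +ᶠ g ∈ ⋁ F₀
    comp  : ∀ {f} φ → UniformlyContinuousOnBounded φ → f ∈ ⋁ F₀ → φ ∘ₛ f ∈ ⋁ F₀
    limit : ∀ {f} → IsUniformLimit (⋁ F₀) f → f ∈ ⋁ F₀

  ⋁-isBishopTopology : (F₀ : Pred (RealFunc X) t) → IsBishopTopology (⋁ F₀)
  ⋁-isBishopTopology F₀ = record
    { resp = resp ; const = const ; add = add ; comp = comp ; limit = limit }

  ⋁-least : {F₀ : Pred (RealFunc X) t} {F : Pred (RealFunc X) t′} →
            IsBishopTopology F → F₀ ⊆ F → ⋁ F₀ ⊆ F
  ⋁-least {F₀ = F₀} {F = F} top F₀⊆F = go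
    where
    module F = IsBishopTopology top
    go : ⋁ F₀ ⊆ F
    go (incl f∈)      = F₀⊆F f∈
    go (resp f≈g f∈)  = F.resp f≈g (go f∈)
    go (const r)      = F.const r
    go (add f∈ g∈)    = F.add (go f∈) (go g∈)
    go (comp φ uc f∈) = F.comp φ uc (go f∈)
    go (limit lim)    = F.limit λ ε ε>0 →
      let (g , g∈ , close) = lim ε ε>0 in g , go g∈ , close

record BishopTopology (X : Setoid a ℓ₁) t : Set (a ⊔ ℓ₁ ⊔ lsuc t) where
  field
    Member           : Pred (RealFunc X) t
    isBishopTopology : IsBishopTopology Member

⋁-topology : {X : Setoid a ℓ₁} → Pred (RealFunc X) t → BishopTopology X (a ⊔ ℓ₁ ⊔ t)
⋁-topology F₀ = record { Member = ⋁ F₀ ; isBishopTopology = ⋁-isBishopTopology F₀ }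

record BishopSpace a ℓ t : Set (lsuc (a ⊔ ℓ ⊔ t)) where
  field
    points   : Setoid a ℓ
    topology : BishopTopology points t

  open BishopTopology topology public

module _ (𝓕 : BishopSpace a ℓ₁ t) (𝓖 : BishopSpace b ℓ₂ t′) where
  private
    module F = BishopSpace 𝓕
    module G = BishopSpace 𝓖

  IsBishopMorphism : Func F.points G.points → Set (b ⊔ ℓ₂ ⊔ t ⊔ t′)
  IsBishopMorphism h = ∀ g → g ∈ G.Member → g ∘ₛ h ∈ F.Member

infix 4 _≅_

record _≅_ (𝓕 : BishopSpace a ℓ₁ t) (𝓖 : BishopSpace b ℓ₂ t′)
           : Set (a ⊔ ℓ₁ ⊔ t ⊔ b ⊔ ℓ₂ ⊔ t′) where
  field
    bijection     : Inverse (BishopSpace.points 𝓕) (BishopSpace.points 𝓖)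
    to-morphism   : IsBishopMorphism 𝓕 𝓖 (toFunction bijection)
    from-morphism : IsBishopMorphism 𝓖 𝓕 (fromFunction bijection)

------------------------------------------------------------------------
-- Directed sets and cofinal subsets

record DirectedSet a ℓ r : Set (lsuc (a ⊔ ℓ ⊔ r)) where
  field
    preorder   : Preorder a ℓ r

  open Preorder preorder public
    using (Carrier; _≈_; reflexive; module Eq)
    renaming (_≲_ to _≼_; refl to ≼-refl; trans to ≼-trans)

  field
    upperBound : ∀ i j → ∃[ k ] i ≼ k × j ≼ k

  setoid : Setoid a ℓ
  setoid = Preorder.Eq.setoid preorder

record CofinalSubset (I : DirectedSet a ℓ r) b ℓ₂ : Set (a ⊔ ℓ ⊔ r ⊔ lsuc (b ⊔ ℓ₂)) where
  private
    module I = DirectedSet I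
  field
    J : Setoid b ℓ₂
    e : Injection J I.setoid

  open Setoid J using () renaming (Carrier to ∣J∣; _≈_ to _≈ᴶ_)
  open Injection e public using () renaming (to to e₀)

  infix 4 _≼ᴶ_

  _≼ᴶ_ : ∣J∣ → ∣J∣ → Set r
  j ≼ᴶ j′ = e₀ j I.≼ e₀ j′

  field
    cof         : Func I.setoid J
    cof-e       : ∀ j → cof ⟨$⟩ e₀ j ≈ᴶ j
    cof-mono    : ∀ {i i′} → i I.≼ i′ → cof ⟨$⟩ i ≼ᴶ cof ⟨$⟩ i′
    cof-cofinal : ∀ i → i I.≼ e₀ (cof ⟨$⟩ i)

  directedSet : DirectedSet b ℓ₂ r
  directedSet = record
    { preorder = record
      { Carrier    = ∣J∣
      ; _≈_        = _≈ᴶ_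
      ; _≲_        = _≼ᴶ_
      ; isPreorder = record
        { isEquivalence = Setoid.isEquivalence J
        ; reflexive     = λ j≈j′ → I.reflexive (Injection.cong e j≈j′)
        ; trans         = I.≼-trans
        }
      }
    ; upperBound = λ j j′ →
        let (k , j≼k , j′≼k) = I.upperBound (e₀ j) (e₀ j′)
        in cof ⟨$⟩ k , I.≼-trans j≼k (cof-cofinal k) , I.≼-trans j′≼k (cof-cofinal k)
    }

------------------------------------------------------------------------
-- Contravariant direct spectra

-- The laws are stated for arbitrary proofs of the order relations, so the
-- transport maps depend only on the indices and not on those proofs.
record ContravariantDirectFamily (I : DirectedSet a ℓ₁ r) c ℓ
       : Set (a ⊔ r ⊔ lsuc (c ⊔ ℓ)) where
  open DirectedSet I using (_≼_) renaming (Carrier to ∣I∣)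
  field
    λ₀          : ∣I∣ → Setoid c ℓ
    transport   : ∀ {i j} → i ≼ j → Func (λ₀ j) (λ₀ i)
    transport-id : ∀ {i} (i≼i : i ≼ i) x →
      Setoid._≈_ (λ₀ i) (transport i≼i ⟨$⟩ x) x
    transport-∘ : ∀ {i j k} (i≼j : i ≼ j) (j≼k : j ≼ k) (i≼k : i ≼ k) x →
      Setoid._≈_ (λ₀ i) (transport i≼k ⟨$⟩ x) (transport i≼j ⟨$⟩ (transport j≼k ⟨$⟩ x))

record ContravariantDirectSpectrum (I : DirectedSet a ℓ₁ r) c ℓ t
       : Set (a ⊔ r ⊔ lsuc (c ⊔ ℓ ⊔ t)) where
  open DirectedSet I using (_≼_) renaming (Carrier to ∣I∣)
  field
    family : ContravariantDirectFamily I c ℓ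

  open ContravariantDirectFamily family public

  field
    topology : ∀ i → BishopTopology (λ₀ i) t

  space : ∣I∣ → BishopSpace c ℓ t
  space i = record { points = λ₀ i ; topology = topology i }

  field
    transport-morphism : ∀ {i j} (i≼j : i ≼ j) →
      IsBishopMorphism (space j) (space i) (transport i≼j)

relativeSpectrum : {I : DirectedSet a ℓ₁ r} → ContravariantDirectSpectrum I c ℓ t →
                   (K : CofinalSubset I b ℓ₂) →
                   ContravariantDirectSpectrum (CofinalSubset.directedSet K) c ℓ t
relativeSpectrum S K = record
  { family = record
    { λ₀           = λ j → λ₀ (e₀ j)
    ; transport    = λ j≼j′ → transport j≼j′
    ; transport-id = λ j≼j → transport-id j≼j
    ; transport-∘  = λ j≼k k≼l j≼l → transport-∘ j≼k k≼l j≼l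
    }
  ; topology           = λ j → topology (e₀ j)
  ; transport-morphism = λ j≼j′ → transport-morphism j≼j′
  }
  where
  open ContravariantDirectSpectrum S
  open CofinalSubset K using (e₀)

------------------------------------------------------------------------
-- Inverse limits

module _ {I : DirectedSet a ℓ₁ r} (S : ContravariantDirectSpectrum I c ℓ t) where
  open DirectedSet I using (_≼_) renaming (Carrier to ∣I∣)
  open ContravariantDirectSpectrum S
  open module λ₀ {i} = Setoid (λ₀ i) using (_≈_)

  -- A thread respects the equality of I because equal indices are ≼-related.
  record Thread : Set (a ⊔ r ⊔ c ⊔ ℓ) where
    field
      at       : ∀ i → Setoid.Carrier (λ₀ i)
      coherent : ∀ {i j} (i≼j : i ≼ j) → at i ≈ transport i≼j ⟨$⟩ at j

  open Thread

  threads : Setoid (a ⊔ r ⊔ c ⊔ ℓ) (a ⊔ ℓ)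
  threads = record
    { Carrier       = Thread
    ; _≈_           = λ Φ Ψ → ∀ i → at Φ i ≈ at Ψ i
    ; isEquivalence = record
      { refl  = λ i → λ₀.refl
      ; sym   = λ Φ≈Ψ i → λ₀.sym (Φ≈Ψ i)
      ; trans = λ Φ≈Ψ Ψ≈Χ i → λ₀.trans (Φ≈Ψ i) (Ψ≈Χ i)
      }
    }

  π : ∀ i → Func threads (λ₀ i)
  π i = record { to = λ Φ → at Φ i ; cong = λ Φ≈Ψ → Φ≈Ψ i }

  LimSubbase : Pred (RealFunc threads) (a ⊔ r ⊔ c ⊔ ℓ ⊔ t)
  LimSubbase h = ∃[ i ] ∃[ f ] f ∈ BishopTopology.Member (topology i) × h ≈ᶠ f ∘ₛ π i

  Lim : BishopSpace (a ⊔ r ⊔ c ⊔ ℓ) (a ⊔ ℓ) (a ⊔ r ⊔ c ⊔ ℓ ⊔ t)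
  Lim = record { points = threads ; topology = ⋁-topology LimSubbase }

{-# OPTIONS --safe #-}

-- A thread over J extends to I by transporting its value at cof i down along
-- i ≼ e (cof i), and this extension is inverse to restriction along e. Both maps
-- are Bishop morphisms because they pull the subbase of one limit back into the
-- subbase of the other: πⱼ ∘ restrict = π (e j), and πᵢ ∘ extend = transport ∘ π (cof i).
module Submission where

open import Data.Product using (_,_)
open import Function.Bundles using (Func; Inverse; _⟨$⟩_)
open import Level using (Level)
open import Relation.Binary.Bundles using (Setoid)
open import Relation.Unary using (Pred; _∈_; _⊆_)
open import Defs

private
  variable
    a ℓ₁ r b ℓ₂ c ℓ t t′ : Level

-- Precomposition with `h` commutes with constants, sums and outer composition on the nose, and a
-- bound valid at every point of `Y` holds at every `h ⟨$⟩ x`.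
preimage-isBishopTopology :
  {X : Setoid a ℓ₁} {Y : Setoid b ℓ₂} {F : Pred (RealFunc X) t} →
  IsBishopTopology F → (h : Func X Y) → IsBishopTopology (λ g → g ∘ₛ h ∈ F)
preimage-isBishopTopology top h = record
  { resp  = λ f≈g → F.resp λ x → f≈g (h ⟨$⟩ x)
  ; const = F.const
  ; add   = F.add
  ; comp  = F.comp
  ; limit = λ lim → F.limit λ ε ε>0 →
      let (g , g∈ , close) = lim ε ε>0 in g ∘ₛ h , g∈ , λ x → close (h ⟨$⟩ x)
  }
  where
  module F = IsBishopTopology top

-- Reduces the morphism property to the subbase: the functions pulled back into `F` form a Bishop
-- topology, so they contain the least one over `G₀`.
⋁-preimage :
  {X : Setoid a ℓ₁} {Y : Setoid b ℓ₂} {F : Pred (RealFunc X) t} {G₀ : Pred (RealFunc Y) t′} →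
  IsBishopTopology F → (h : Func X Y) →
  G₀ ⊆ (λ g → g ∘ₛ h ∈ F) → ⋁ G₀ ⊆ (λ g → g ∘ₛ h ∈ F)
⋁-preimage top h = ⋁-least (preimage-isBishopTopology top h)

module _ {I : DirectedSet a ℓ₁ r} (S : ContravariantDirectSpectrum I c ℓ t)
         (K : CofinalSubset I b ℓ₂) where
  open DirectedSet I using (_≼_; ≼-trans)
  open ContravariantDirectSpectrum S
  open CofinalSubset K
  open Thread

  private
    S∘e : ContravariantDirectSpectrum directedSet c ℓ t
    S∘e = relativeSpectrum S K

    module ≈ {i} = Setoid (λ₀ i)

  restrict : Func (threads S) (threads S∘e)
  restrict = record
    { to   = λ Φ → record
      { at       = λ j → at Φ (e₀ j)
      ; coherent = λ j≼j′ → coherent Φ j≼j′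
      }
    ; cong = λ Φ≈Ψ j → Φ≈Ψ (e₀ j)
    }

  extend : Func (threads S∘e) (threads S)
  extend = record
    { to   = λ Φ → record
      { at       = λ i → transport (cof-cofinal i) ⟨$⟩ at Φ (cof ⟨$⟩ i)
      ; coherent = λ {i} {i′} i≼i′ →
          let i≼cof-i′ = ≼-trans i≼i′ (cof-cofinal i′) in
          -- Coherence over J moves the value to `cof ⟨$⟩ i′`; the paths from `i` through
          -- `e₀ (cof ⟨$⟩ i)` and through `i′` then agree with the direct transport along
          -- `i≼cof-i′`.
          ≈.trans (Func.cong (transport (cof-cofinal i)) (coherent Φ (cof-mono i≼i′)))
            (≈.trans (≈.sym (transport-∘ (cof-cofinal i) (cof-mono i≼i′) i≼cof-i′ _))
              (transport-∘ i≼i′ (cof-cofinal i′) i≼cof-i′ _))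
      }
    ; cong = λ Φ≈Ψ i → Func.cong (transport (cof-cofinal i)) (Φ≈Ψ (cof ⟨$⟩ i))
    }

  threads-inverse : Inverse (threads S∘e) (threads S)
  threads-inverse = record
    { to        = extend ⟨$⟩_
    ; from      = restrict ⟨$⟩_
    ; to-cong   = λ {Φ} {Ψ} → Func.cong extend {Φ} {Ψ}
    ; from-cong = λ {Φ} {Ψ} → Func.cong restrict {Φ} {Ψ}
    ; inverse   =
        (λ {Φ} Ψ≈restrictΦ i → ≈.trans
          (Func.cong (transport (cof-cofinal i)) (Ψ≈restrictΦ (cof ⟨$⟩ i)))
          (≈.sym (coherent Φ (cof-cofinal i))))
      -- Since `≼ᴶ` is the order of I along `e₀`, `cof-cofinal (e₀ j)` also proves
      -- `j ≼ᴶ cof ⟨$⟩ e₀ j`, so coherence over J applies.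
      , (λ {Φ} Ψ≈extendΦ j → ≈.trans (Ψ≈extendΦ (e₀ j))
          (≈.sym (coherent Φ (cof-cofinal (e₀ j)))))
    }

  restrict-morphism : IsBishopMorphism (Lim S) (Lim S∘e) restrict
  restrict-morphism _ = ⋁-preimage (⋁-isBishopTopology (LimSubbase S)) restrict
    λ { (j , f , f∈ , h≈f∘π) →
        incl (e₀ j , f , f∈ , λ Φ → h≈f∘π (restrict ⟨$⟩ Φ)) }

  extend-morphism : IsBishopMorphism (Lim S∘e) (Lim S) extend
  extend-morphism _ = ⋁-preimage (⋁-isBishopTopology (LimSubbase S∘e)) extend
    λ { (i , f , f∈ , h≈f∘π) →
        -- The transport is a Bishop morphism, so `f` composed with it lies in the topology at
        -- `e₀ (cof ⟨$⟩ i)`.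
        incl ( cof ⟨$⟩ i , f ∘ₛ transport (cof-cofinal i)
             , transport-morphism (cof-cofinal i) f f∈
             , λ Φ → h≈f∘π (extend ⟨$⟩ Φ)) }

theorem10p5 : ∀ {a ℓ₁ r b ℓ₂ c ℓ t : Level}
    (I : DirectedSet a ℓ₁ r)
    (S : ContravariantDirectSpectrum I c ℓ t)
    (J : CofinalSubset I b ℓ₂) →
    Lim (relativeSpectrum S J) ≅ Lim S
theorem10p5 I S J = record
  { bijection     = threads-inverse S J
  ; to-morphism   = extend-morphism S J
  ; from-morphism = restrict-morphism S J
  }
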